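{- Let $\mathcal{K}$ be a finite class of similar finite smooth idempotent algebras and $\mathbb{A}\in\mathcal{K}$. For any affine edge $ab$ of $\mathbb{A}$, where $\theta$ is a witnessing congruence of $\mathsf{Sg}\{a,b\}$, there is $b'\in b/\theta$ such that $ab'$ is a thin affine edge.
   Context: $\mathsf{Sg}\{a,b\}$ is the subalgebra generated by $a,b$. For a congruence $\theta$ of $\mathsf{Sg}\{a,b\}$, $a/\theta$ is the $\theta$-block of $a$ and $f/\theta$ the operation induced by $f$ on the quotient. An algebra is called a module if it is term equivalent to the full idempotent reduct of a module over a ring (the reduct whose operations are all idempotent term operations of that module), with affine operation $x-y+z$. Edges: a pair $ab$ of distinct elements of an idempotent algebra is a semilattice edge witnessed by a congruence $\theta$ of $\mathsf{Sg}\{a,b\}$ with $a/\theta\ne b/\theta$ if some binary term operation induces a semilattice operation on $\{a/\theta,b/\theta\}$; a majority edge witnessed by $\theta$ if some ternary term operation induces a majority operation on $\{a/\theta,b/\theta\}$ but no term operation induces a semilattice operation there; an affine edge witnessed by $\theta$ if $\mathsf{Sg}\{a,b\}/\theta$ is a module and some term operation induces its operation $x-y+z$. In each case $E=\{a/\theta,b/\theta\}$ is a thick edge of that type. An idempotent algebra is smooth if for every thick edge $\{a/\theta,b/\theta\}$ of semilattice or majority type the set $a/\theta\cup b/\theta$ is a subuniverse. Fix term operations $f$ (binary), $g,h$ (ternary) of $\mathcal{K}$ such that for every thick edge $E=\{a/\theta,b/\theta\}$ of every $\mathbb{A}\in\mathcal{K}$: if $E$ is semilattice, $f$ is a semilattice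 operation on $E$ and $g(x,y,z)=h(x,y,z)=f(x,f(y,z))$ on $E$; if $E$ is majority, on $E$ $f,h$ are first projections and $g$ is a majority operation; if $E$ is affine, $f,g$ are first projections on $E$ and $h/\theta$ is $x-y+z$ on $\mathsf{Sg}\{a,b\}/\theta$; and the identities $f(x,f(x,y))=f(x,y)$, $g(x,g(x,y,y),g(x,y,y))=g(x,y,y)$, $h(h(x,y,y),y,y)=h(x,y,y)$ hold in $\mathcal{K}$. (Such operations exist.) A ternary term operation $h'$ satisfies the minority condition (with respect to $\mathcal{K}$) if $h'(h'(x,y,y),y,y)=h'(x,y,y)$ holds in $\mathcal{K}$ and for every affine edge $ab$ of any $\mathbb{B}\in\mathcal{K}$ witnessed by $\theta$, $h'/\theta$ is a Mal'tsev operation on $\mathsf{Sg}\{a,b\}/\theta$. A pair $ab$ of distinct elements of $\mathbb{A}\in\mathcal{K}$ is a thin affine edge (with respect to $\mathcal{K}$) if $h(b,a,a)=b$ for the fixed operation $h$ and $b\in\mathsf{Sg}\{a,h'(a,a,b)\}$ for every term operation $h'$ satisfying the minority condition. -}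

module Defs where

open import Level using (0ℓ)
open import Algebra.Bundles using (Ring)
open import Algebra.Core using (Op₁; Op₂)
open import Algebra.Lattice.Structures using (IsSemilattice)
open import Algebra.Module.Core using (Opₗ)
open import Algebra.Module.Structures using (IsLeftModule)
open import Data.Fin.Base using (Fin)
open import Data.Fin.Patterns using (0F; 1F)
open import Data.Nat.Base using (ℕ; suc)
open import Data.Product.Base using (Σ; Σ-syntax; ∃-syntax; _×_; _,_; proj₁; proj₂)
open import Data.Sum.Base using (_⊎_; inj₁; inj₂)
open import Data.Vec.Functional using (Vector; []; _∷_; replicate)
open import Function.Base using (_∘_)
open import Function.Bundles using (Inverse)
open import Relation.Binary.Bundles using (Setoid)
open import Relation.Binary.Core using (Rel)
open import Relation.Binary.Structures using (IsEquivalence)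
import Relation.Binary.Construct.On as On
import Relation.Binary.PropositionalEquality.Properties as ≡
open import Relation.Nullary.Negation.Core using (¬_)
open import Relation.Unary using (Pred; _∈_; _∪_)

-- Equality of elements of an algebra is the equality of a setoid, so that
-- subalgebras (Σ-types compared on first components) and quotients (the same
-- type with a coarser equality) are again algebras.

record Signature : Set₁ where
  field
    Symbol : Set
    arity  : Symbol → ℕ

open Signature

record Structure (S : Signature) (X : Setoid 0ℓ 0ℓ) : Set where
  open Setoid X using (Carrier; _≈_)
  field
    ⟦_⟧     : (o : Symbol S) → Vector Carrier (arity S o) → Carrier
    ⟦⟧-cong : ∀ o {xs ys} → (∀ i → xs i ≈ ys i) → ⟦ o ⟧ xs ≈ ⟦ o ⟧ ys

record Algebra (S : Signature) : Set₁ where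
  field
    setoid    : Setoid 0ℓ 0ℓ
    structure : Structure S setoid

  open Setoid setoid public
  open Structure structure public

data Term (S : Signature) (n : ℕ) : Set where
  var  : Fin n → Term S n
  node : (o : Symbol S) → (Fin (arity S o) → Term S n) → Term S n

module _ {S : Signature} {X : Setoid 0ℓ 0ℓ} (M : Structure S X) where
  open Setoid X
  open Structure M

  eval : ∀ {n} → Term S n → Vector Carrier n → Carrier
  eval (var i)     xs = xs i
  eval (node o ts) xs = ⟦ o ⟧ (λ j → eval (ts j) xs)

  eval-cong : ∀ {n} (t : Term S n) {xs ys} →
              (∀ i → xs i ≈ ys i) → eval t xs ≈ eval t ys
  eval-cong (var i)     p = p i
  eval-cong (node o ts) p = ⟦⟧-cong o (λ j → eval-cong (ts j) p)

  IdempotentTerm : ∀ {n} → Term S n → Set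
  IdempotentTerm t = ∀ x → eval t (replicate _ x) ≈ x

module _ {S : Signature} (A : Algebra S) where
  open Algebra A

  op₂ : Term S 2 → Carrier → Carrier → Carrier
  op₂ t x y = eval structure t (x ∷ y ∷ [])

  op₃ : Term S 3 → Carrier → Carrier → Carrier → Carrier
  op₃ t x y z = eval structure t (x ∷ y ∷ z ∷ [])

  IsFinite : Set
  IsFinite = ∃[ n ] Inverse setoid (≡.setoid (Fin n))

  IsIdempotent : Set
  IsIdempotent = ∀ o x → ⟦ o ⟧ (replicate _ x) ≈ x

  record IsSubuniverse (P : Pred Carrier 0ℓ) : Set where
    field
      resp   : ∀ {x y} → x ≈ y → x ∈ P → y ∈ P
      closed : ∀ o xs → (∀ i → xs i ∈ P) → ⟦ o ⟧ xs ∈ P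

  subalgebra : ∀ {P} → IsSubuniverse P → Algebra S
  subalgebra {P} sub = record
    { setoid    = On.setoid {B = Σ Carrier P} setoid proj₁
    ; structure = record
      { ⟦_⟧     = λ o xs → ⟦ o ⟧ (proj₁ ∘ xs) , closed o (proj₁ ∘ xs) (proj₂ ∘ xs)
      ; ⟦⟧-cong = λ o → ⟦⟧-cong o
      }
    }
    where open IsSubuniverse sub

  data Generated (P : Pred Carrier 0ℓ) : Pred Carrier 0ℓ where
    gen  : ∀ {x} → x ∈ P → x ∈ Generated P
    app  : ∀ o xs → (∀ i → xs i ∈ Generated P) → ⟦ o ⟧ xs ∈ Generated P
    resp : ∀ {x y} → x ≈ y → x ∈ Generated P → y ∈ Generated P

  generated-isSubuniverse : ∀ P → IsSubuniverse (Generated P)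
  generated-isSubuniverse P = record { resp = resp ; closed = app }

  Pair : Carrier → Carrier → Pred Carrier 0ℓ
  Pair a b x = x ≈ a ⊎ x ≈ b

  Sg : Carrier → Carrier → Pred Carrier 0ℓ
  Sg a b = Generated (Pair a b)

  SgAlgebra : Carrier → Carrier → Algebra S
  SgAlgebra a b = subalgebra (generated-isSubuniverse (Pair a b))

  fstGen : ∀ a b → Algebra.Carrier (SgAlgebra a b)
  fstGen a b = a , gen (inj₁ refl)

  sndGen : ∀ a b → Algebra.Carrier (SgAlgebra a b)
  sndGen a b = b , gen (inj₂ refl)

  record Congruence : Set₁ where
    field
      _∼_             : Rel Carrier 0ℓ
      ∼-isEquivalence : IsEquivalence _∼_
      ≈⇒∼             : ∀ {x y} → x ≈ y → x ∼ y
      compatible      : ∀ o {xs ys} → (∀ i → xs i ∼ ys i) → ⟦ o ⟧ xs ∼ ⟦ o ⟧ ys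

  quotient : Congruence → Algebra S
  quotient θ = record
    { setoid    = record { isEquivalence = ∼-isEquivalence }
    ; structure = record { ⟦_⟧ = ⟦_⟧ ; ⟦⟧-cong = compatible }
    }
    where open Congruence θ

-- Clones consist of operations of positive arity; hence only terms in
-- suc n variables are considered. (Constants are still allowed inside terms.)

TermEquivalent : ∀ {S T X} → Structure S X → Structure T X → Set
TermEquivalent {S} {T} {X} M N =
    (∀ {n} (s : Term S (suc n)) → ∃[ t ] (∀ xs → eval M s xs ≈ eval N {suc n} t xs))
  × (∀ {n} (t : Term T (suc n)) → ∃[ s ] (∀ xs → eval M {suc n} s xs ≈ eval N t xs))
  where open Setoid X

idempotentSignature : ∀ {S X} → Structure S X → Signature
idempotentSignature {S} M = record
  { Symbol = Σ[ n ∈ ℕ ] Σ[ t ∈ Term S (suc n) ] IdempotentTerm M t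
  ; arity  = suc ∘ proj₁
  }

fullIdempotentReduct : ∀ {S X} (M : Structure S X) → Structure (idempotentSignature M) X
fullIdempotentReduct M = record
  { ⟦_⟧     = λ (_ , t , _) → eval M t
  ; ⟦⟧-cong = λ (_ , t , _) → eval-cong M t
  }

data ModuleSymbol (R : Set) : Set where
  zero neg add : ModuleSymbol R
  scale        : R → ModuleSymbol R

moduleSignature : Set → Signature
moduleSignature R = record
  { Symbol = ModuleSymbol R
  ; arity  = λ where
      zero      → 0
      neg       → 1
      add       → 2
      (scale _) → 1
  }

-- Left modules suffice: a right module is a left module over the opposite
-- ring with the same operations.

record ModuleOn (X : Setoid 0ℓ 0ℓ) : Set₁ where
  open Setoid X using (Carrier; _≈_) renaming (refl to ≈-refl)
  field
    ring         : Ring 0ℓ 0ℓ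
    _+ᴹ_         : Op₂ Carrier
    0ᴹ           : Carrier
    -ᴹ_          : Op₁ Carrier
    _*ₗ_         : Opₗ (Ring.Carrier ring) Carrier
    isLeftModule : IsLeftModule ring _≈_ _+ᴹ_ 0ᴹ -ᴹ_ _*ₗ_

  open IsLeftModule isLeftModule using (+ᴹ-cong; -ᴹ‿cong; *ₗ-cong)

  affine : Carrier → Carrier → Carrier → Carrier
  affine x y z = (x +ᴹ (-ᴹ y)) +ᴹ z

  moduleStructure : Structure (moduleSignature (Ring.Carrier ring)) X
  moduleStructure = record
    { ⟦_⟧ = λ where
        zero      xs → 0ᴹ
        neg       xs → -ᴹ (xs 0F)
        add       xs → xs 0F +ᴹ xs 1F
        (scale r) xs → r *ₗ xs 0F
    ; ⟦⟧-cong = λ where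
        zero      p → ≈-refl
        neg       p → -ᴹ‿cong (p 0F)
        add       p → +ᴹ-cong (p 0F) (p 1F)
        (scale r) p → *ₗ-cong (Ring.refl ring) (p 0F)
    }

-- The module is part of the data, since its operation x - y + z is referred to
-- later; that operation does not depend on the choice of the module.

record IsModule {S : Signature} (A : Algebra S) : Set₁ where
  open Algebra A
  field
    moduleOn       : ModuleOn setoid
    termEquivalent : TermEquivalent structure
                       (fullIdempotentReduct (ModuleOn.moduleStructure moduleOn))

  open ModuleOn moduleOn public

module _ (X : Setoid 0ℓ 0ℓ) (E : Pred (Setoid.Carrier X) 0ℓ) where
  open Setoid X

  SemilatticeOn : Op₂ Carrier → Set
  SemilatticeOn f =
    Σ[ closed ∈ (∀ {x y} → x ∈ E → y ∈ E → f x y ∈ E) ]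
      IsSemilattice {A = Σ Carrier E} (λ u v → proj₁ u ≈ proj₁ v)
        (λ (x , x∈E) (y , y∈E) → f x y , closed x∈E y∈E)

  record MajorityOn (m : Carrier → Carrier → Carrier → Carrier) : Set where
    field
      closed : ∀ {x y z} → x ∈ E → y ∈ E → z ∈ E → m x y z ∈ E
      maj₁   : ∀ {x y} → x ∈ E → y ∈ E → m x x y ≈ x
      maj₂   : ∀ {x y} → x ∈ E → y ∈ E → m x y x ≈ x
      maj₃   : ∀ {x y} → x ∈ E → y ∈ E → m y x x ≈ x

  FirstProjection₂On : Op₂ Carrier → Set
  FirstProjection₂On f = ∀ {x y} → x ∈ E → y ∈ E → f x y ≈ x

  FirstProjection₃On : (Carrier → Carrier → Carrier → Carrier) → Set
  FirstProjection₃On t = ∀ {x y z} → x ∈ E → y ∈ E → z ∈ E → t x y z ≈ x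

module _ (X : Setoid 0ℓ 0ℓ) where
  open Setoid X

  IsMal'tsev : (Carrier → Carrier → Carrier → Carrier) → Set
  IsMal'tsev p = ∀ x y → p x x y ≈ y × p y x x ≈ y

module _ {S : Signature} (A : Algebra S)
         (a b : Algebra.Carrier A) (θ : Congruence (SgAlgebra A a b)) where

  open Algebra A using (Carrier)
  open Congruence θ using (_∼_)

  private
    Q : Algebra S
    Q = quotient (SgAlgebra A a b) θ

  -- For c ∈ Sg{a,b}, the θ-block of c as a subset of A.
  Block : Algebra.Carrier (SgAlgebra A a b) → Pred Carrier 0ℓ
  Block c x = Σ[ x∈Sg ∈ (x ∈ Sg A a b) ] (x , x∈Sg) ∼ c

  fstBlock sndBlock : Pred Carrier 0ℓ
  fstBlock = Block (fstGen A a b)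
  sndBlock = Block (sndGen A a b)

  -- The thick edge {a/θ , b/θ}, as a subset of Sg{a,b}/θ.
  ThickEdge : Pred (Algebra.Carrier Q) 0ℓ
  ThickEdge = Pair Q (fstGen A a b) (sndGen A a b)

  Separates : Set
  Separates = ¬ (fstGen A a b ∼ sndGen A a b)

  IsSemilatticeEdge : Set
  IsSemilatticeEdge =
    Separates × ∃[ t ] SemilatticeOn (Algebra.setoid Q) ThickEdge (op₂ Q t)

  IsMajorityEdge : Set
  IsMajorityEdge =
      Separates
    × (∃[ t ] MajorityOn (Algebra.setoid Q) ThickEdge (op₃ Q t))
    × ¬ (∃[ t ] SemilatticeOn (Algebra.setoid Q) ThickEdge (op₂ Q t))

  record IsAffineEdge : Set₁ where
    field
      separates  : Separates
      isModule   : IsModule Q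
    open IsModule isModule public using (affine)
    field
      affineTerm : ∃[ t ] (∀ x y z → op₃ Q t x y z ∼ affine x y z)

IsSmooth : ∀ {S} → Algebra S → Set₁
IsSmooth A = ∀ a b (θ : Congruence (SgAlgebra A a b)) →
  IsSemilatticeEdge A a b θ ⊎ IsMajorityEdge A a b θ →
  IsSubuniverse A (fstBlock A a b θ ∪ sndBlock A a b θ)

module _ {S : Signature} {I : Set} (K : I → Algebra S) where

  record AreBasicOperations (f : Term S 2) (g h : Term S 3) : Set₁ where
    field
      semilattice : ∀ i a b θ →
        let Q = quotient (SgAlgebra (K i) a b) θ
            E = ThickEdge (K i) a b θ
            _∼_ = Algebra._≈_ Q
        in IsSemilatticeEdge (K i) a b θ →
           SemilatticeOn (Algebra.setoid Q) E (op₂ Q f)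
         × (∀ {x y z} → x ∈ E → y ∈ E → z ∈ E →
              op₃ Q g x y z ∼ op₂ Q f x (op₂ Q f y z)
            × op₃ Q h x y z ∼ op₂ Q f x (op₂ Q f y z))
      majority : ∀ i a b θ →
        let Q = quotient (SgAlgebra (K i) a b) θ
            E = ThickEdge (K i) a b θ
            X = Algebra.setoid Q
        in IsMajorityEdge (K i) a b θ →
           FirstProjection₂On X E (op₂ Q f)
         × MajorityOn X E (op₃ Q g)
         × FirstProjection₃On X E (op₃ Q h)
      affine : ∀ i a b θ →
        let Q = quotient (SgAlgebra (K i) a b) θ
            E = ThickEdge (K i) a b θ
            X = Algebra.setoid Q
            _∼_ = Algebra._≈_ Q
        in (e : IsAffineEdge (K i) a b θ) →
           FirstProjection₂On X E (op₂ Q f)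
         × FirstProjection₃On X E (op₃ Q g)
         × (∀ x y z → op₃ Q h x y z ∼ IsAffineEdge.affine e x y z)
      f-identity : ∀ i →
        let _≈_ = Algebra._≈_ (K i)
            f′ = op₂ (K i) f
        in ∀ x y → f′ x (f′ x y) ≈ f′ x y
      g-identity : ∀ i →
        let _≈_ = Algebra._≈_ (K i)
            g′ = op₃ (K i) g
        in ∀ x y → g′ x (g′ x y y) (g′ x y y) ≈ g′ x y y
      h-identity : ∀ i →
        let _≈_ = Algebra._≈_ (K i)
            h′ = op₃ (K i) h
        in ∀ x y → h′ (h′ x y y) y y ≈ h′ x y y

  record MinorityCondition (t : Term S 3) : Set₁ where
    field
      identity : ∀ i →
        let _≈_ = Algebra._≈_ (K i)
            t′ = op₃ (K i) t
        in ∀ x y → t′ (t′ x y y) y y ≈ t′ x y y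
      mal'tsev : ∀ i a b θ →
        let Q = quotient (SgAlgebra (K i) a b) θ
        in IsAffineEdge (K i) a b θ → IsMal'tsev (Algebra.setoid Q) (op₃ Q t)

  -- h is the third of the basic operations f, g, h fixed for the class.
  record IsThinAffineEdge (h : Term S 3) i (a b : Algebra.Carrier (K i)) : Set₁ where
    open Algebra (K i) using (_≈_)
    field
      distinct  : ¬ (a ≈ b)
      h-fixed   : op₃ (K i) h b a a ≈ b
      generates : ∀ t → MinorityCondition t → b ∈ Sg (K i) a (op₃ (K i) t a a b)

-- Among the elements c of the block b/θ choose one with Sg{a,c} minimal, and
-- replace it by b′ = h(c,a,a), which still lies in b/θ (h is Mal'tsev modulo θ)
-- and in Sg{a,c}, so it is minimal as well. If h′ satisfies the minority
-- condition, then h′(a,a,b′) also lies in b/θ and in Sg{a,b′}, and minimality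
-- gives Sg{a,h′(a,a,b′)} = Sg{a,b′}.

module Submission where

open import Defs
open import Level using (0ℓ)
open import Algebra.Module.Structures using (IsLeftModule)
open import Axiom.ExcludedMiddle using (ExcludedMiddle)
open import Data.Fin.Base using (Fin)
open import Data.Fin.Induction using (spo-wellFounded)
open import Data.Fin.Patterns using (0F; 1F; 2F)
open import Data.Nat.Base using (ℕ)
open import Data.Product.Base using (∃-syntax; _×_; _,_; proj₁; proj₂)
open import Data.Sum.Base using (inj₁; inj₂)
open import Data.Vec.Functional using (Vector)
open import Function.Bundles using (Inverse)
open import Induction.WellFounded using (WellFounded; Acc; acc; module Subrelation)
open import Relation.Binary.Bundles using (Setoid)
open import Relation.Binary.Core using (Rel)
open import Relation.Binary.Structures using (IsPreorder; IsStrictPartialOrder)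
import Relation.Binary.Construct.On as On
import Relation.Binary.PropositionalEquality as ≡
open import Relation.Nullary.Decidable.Core using (yes; no; decidable-stable)
open import Relation.Nullary.Negation.Core using (¬_)
open import Relation.Unary using (Pred; _∈_; _⊆_)

module _ {X : Setoid 0ℓ 0ℓ} {n : ℕ} (X↔Fin : Inverse X (≡.setoid (Fin n)))
         {_≲_ : Rel (Setoid.Carrier X) 0ℓ}
         (isPreorder : IsPreorder (Setoid._≈_ X) _≲_) where

  open Setoid X using (Carrier; _≈_)
  open Inverse X↔Fin using (to; from; strictlyInverseʳ)
  open IsPreorder isPreorder using (reflexive; trans; module Eq)

  private
    _⋨_ : Rel Carrier 0ℓ
    x ⋨ y = x ≲ y × ¬ y ≲ x

    ⋨-trans : ∀ {x y z} → x ⋨ y → y ⋨ z → x ⋨ z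
    ⋨-trans (x≲y , y≴x) (y≲z , _) = trans x≲y y≲z , λ z≲x → y≴x (trans y≲z z≲x)

    ⋨-resp : ∀ {x x′ y y′} → x ≈ x′ → y ≈ y′ → x ⋨ y → x′ ⋨ y′
    ⋨-resp x≈x′ y≈y′ (x≲y , y≴x) =
        trans (reflexive (Eq.sym x≈x′)) (trans x≲y (reflexive y≈y′))
      , λ y′≲x′ → y≴x (trans (reflexive y≈y′) (trans y′≲x′ (reflexive (Eq.sym x≈x′))))

  -- Every strict partial order on `Fin n` is well-founded. Pulling `_⋨_` back along `from` gives
  -- such an order, and `x ⋨ y` implies `from (to x) ⋨ from (to y)` because `from (to x) ≈ x`.
  ⋨-wellFounded : WellFounded _⋨_
  ⋨-wellFounded = Subrelation.wellFounded
    (⋨-resp (Eq.sym (strictlyInverseʳ _)) (Eq.sym (strictlyInverseʳ _)))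
    (On.wellFounded to (spo-wellFounded record
      { isEquivalence = ≡.isEquivalence
      ; irrefl        = λ { ≡.refl (x≲x , x≴x) → x≴x x≲x }
      ; trans         = ⋨-trans
      ; <-resp-≈      = ≡.resp₂ (λ i j → from i ⋨ from j)
      }))

  -- Descend along `_⋨_` for as long as `P` has a strictly smaller element. Minimality is meant for
  -- a preorder: `m ≲ y` rather than `m ≈ y`, since different elements can generate the same
  -- subalgebra.
  ∃-minimal : ExcludedMiddle 0ℓ → {P : Pred Carrier 0ℓ} → ∀ {x} → x ∈ P →
              ∃[ m ] (m ∈ P × (∀ {y} → y ∈ P → y ≲ m → m ≲ y))
  ∃-minimal em {P} {x} = go (⋨-wellFounded x)
    where
    go : ∀ {x} → Acc _⋨_ x → x ∈ P → ∃[ m ] (m ∈ P × (∀ {y} → y ∈ P → y ≲ m → m ≲ y))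
    go {x} (acc rs) x∈P with em {∃[ y ] (y ∈ P × y ⋨ x)}
    ... | yes (y , y∈P , y⋨x) = go (rs y⋨x) y∈P
    ... | no  ∄y              = x , x∈P , λ {y} y∈P y≲x →
            -- `P` has no element strictly below `x`, so `¬ x ≲ y` is refuted; excluded middle
            -- removes the double negation.
            decidable-stable em (λ x≴y → ∄y (y , y∈P , y≲x , x≴y))

module _ {S : Signature} (A : Algebra S) where
  open Algebra A

  generated-minimal : ∀ {P Q} → IsSubuniverse A Q → P ⊆ Q → Generated A P ⊆ Q
  generated-minimal sub P⊆Q (gen x∈P)     = P⊆Q x∈P
  generated-minimal sub P⊆Q (app o xs p)  =
    IsSubuniverse.closed sub o xs (λ i → generated-minimal sub P⊆Q (p i))
  generated-minimal sub P⊆Q (resp x≈y p)  =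
    IsSubuniverse.resp sub x≈y (generated-minimal sub P⊆Q p)

  eval-closed : ∀ {P} → IsSubuniverse A P → ∀ {n} (t : Term S n) {xs} →
                (∀ i → xs i ∈ P) → eval structure t xs ∈ P
  eval-closed sub (var i)     p = p i
  eval-closed sub (node o ts) p =
    IsSubuniverse.closed sub o _ (λ j → eval-closed sub (ts j) p)

  op₃-closed : ∀ {P} → IsSubuniverse A P → ∀ t {x y z} →
               x ∈ P → y ∈ P → z ∈ P → op₃ A t x y z ∈ P
  op₃-closed sub t x∈P y∈P z∈P =
    eval-closed sub t λ { 0F → x∈P ; 1F → y∈P ; 2F → z∈P }

  -- This is inclusion of the subalgebras Sg{a,x}, expressed on generators: `x ∈ Sg A a y` holds
  -- exactly when Sg{a,x} is contained in Sg{a,y}.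
  Sg-isPreorder : ∀ a → IsPreorder _≈_ (λ x y → x ∈ Sg A a y)
  Sg-isPreorder a = record
    { isEquivalence = isEquivalence
    ; reflexive     = λ x≈y → gen (inj₂ x≈y)
    ; trans         = λ x∈Sgay y∈Sgaz → generated-minimal (generated-isSubuniverse A _)
        (λ { (inj₁ u≈a) → gen (inj₁ u≈a) ; (inj₂ u≈y) → resp (sym u≈y) y∈Sgaz }) x∈Sgay
    }

  module _ {a b : Carrier} (θ : Congruence (SgAlgebra A a b)) where
    open Congruence θ

    private
      Q : Algebra S
      Q = quotient (SgAlgebra A a b) θ

    -- The quotient keeps the carrier and operations of Sg{a,b}, so values agree up to `≈` and not
    -- merely modulo `θ`. The hypothesis is pointwise because vectors are functions, without
    -- extensionality.
    eval-quotient : ∀ {n} (t : Term S n) {us : Vector (Algebra.Carrier Q) n} {xs} →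
                    (∀ i → proj₁ (us i) ≈ xs i) →
                    proj₁ (eval (Algebra.structure Q) t us) ≈ eval structure t xs
    eval-quotient (var i)     p = p i
    eval-quotient (node o ts) p = ⟦⟧-cong o (λ j → eval-quotient (ts j) p)

    -- Turns a congruence computed in Sg{a,b}/θ into membership in a block, seen as a subset of `A`.
    op₃-block : ∀ t {u v w c} → op₃ Q t u v w ∼ c →
                op₃ A t (proj₁ u) (proj₁ v) (proj₁ w) ∈ Block A a b θ c
    op₃-block t {u} {v} {w} t∼c =
        resp eq (proj₂ (op₃ Q t u v w))
      , Algebra.trans Q (≈⇒∼ (sym eq)) t∼c
      where
      eq : proj₁ (op₃ Q t u v w) ≈ op₃ A t (proj₁ u) (proj₁ v) (proj₁ w)
      eq = eval-quotient t λ { 0F → refl ; 1F → refl ; 2F → refl }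

module _ {X : Setoid 0ℓ 0ℓ} (M : ModuleOn X) where
  open Setoid X
  open ModuleOn M
  open IsLeftModule isLeftModule using (+ᴹ-cong; +ᴹ-assoc; -ᴹ‿inverseˡ; +ᴹ-identityʳ)

  affine-cancelʳ : ∀ x y → affine x y y ≈ x
  affine-cancelʳ x y =
    trans (+ᴹ-assoc x (-ᴹ y) y) (trans (+ᴹ-cong refl (-ᴹ‿inverseˡ y)) (+ᴹ-identityʳ x))

corollary4p11 : ExcludedMiddle 0ℓ →
    (S : Signature) (k : ℕ) (K : Fin k → Algebra S) →
    (∀ i → IsFinite (K i)) →
    (∀ i → IsIdempotent (K i)) →
    (∀ i → IsSmooth (K i)) →
    (f : Term S 2) (g h : Term S 3) → AreBasicOperations K f g h →
    (i : Fin k) (a b : Algebra.Carrier (K i)) (θ : Congruence (SgAlgebra (K i) a b)) →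
    IsAffineEdge (K i) a b θ →
    ∃[ b′ ] (b′ ∈ sndBlock (K i) a b θ × IsThinAffineEdge K h i a b′)
corollary4p11 em S k K fin _ _ f g h basic i a b θ edge
  -- The descent starts at `b`, which lies in its own block.
  with c , c∈b/θ , c-minimal ← ∃-minimal (proj₂ (fin i)) (Sg-isPreorder (K i) a) em
         {P = sndBlock (K i) a b θ} (proj₂ (sndGen (K i) a b) , Congruence.≈⇒∼ θ (Algebra.refl (K i)))
  = b′ , b′∈b/θ , record
      { distinct  = λ a≈b′ → separates (Q.trans (≈⇒∼ a≈b′) (proj₂ b′∈b/θ))
      -- The identity h(h(x,y,y),y,y) = h(x,y,y) at x = c, y = a; this is the reason for passing
      -- from `c` to `b′`.
      ; h-fixed   = h-identity i c a
      ; generates = λ t minority →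
          let d     = op₃ A t a a b′
              d∈b/θ = op₃-block A θ t (Q.trans
                        (proj₁ (MinorityCondition.mal'tsev minority i a b θ edge a′ (b′ , proj₁ b′∈b/θ)))
                        (proj₂ b′∈b/θ))
              d≲b′  = op₃-closed A (Sg-isSubuniverse b′) t (a∈Sg b′) (a∈Sg b′) (≲.refl {b′})
          -- Minimality is available at `c`: from `d ≲ b′ ≲ c` it yields `c ≲ d`, hence
          -- `b′ ≲ c ≲ d`.
          in ≲.trans {b′} {c} {d} b′≲c (c-minimal d∈b/θ (≲.trans {d} {b′} {c} d≲b′ b′≲c))
      }
  where
  A : Algebra S
  A = K i

  module Q = Algebra (quotient (SgAlgebra A a b) θ)
  module ≲ = IsPreorder (Sg-isPreorder A a)
  open AreBasicOperations basic using (affine; h-identity)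
  open IsAffineEdge edge using (separates; isModule)
  open Congruence θ using (≈⇒∼)

  a′ : Q.Carrier
  a′ = fstGen A a b

  Sg-isSubuniverse : ∀ x → IsSubuniverse A (Sg A a x)
  Sg-isSubuniverse x = generated-isSubuniverse A (Pair A a x)

  a∈Sg : ∀ x → a ∈ Sg A a x
  a∈Sg x = proj₂ (fstGen A a x)

  b′ : Algebra.Carrier A
  b′ = op₃ A h c a a

  b′≲c : b′ ∈ Sg A a c
  b′≲c = op₃-closed A (Sg-isSubuniverse c) h (≲.refl {c}) (a∈Sg c) (a∈Sg c)

  b′∈b/θ : b′ ∈ sndBlock A a b θ
  -- Modulo `θ`, h(c,a,a) is c - a + a = c, and `c` is congruent to `b`.
  b′∈b/θ = op₃-block A θ h (Q.trans
    (proj₂ (proj₂ (affine i a b θ edge)) (c , proj₁ c∈b/θ) a′ a′)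
    (Q.trans (affine-cancelʳ (IsModule.moduleOn isModule) (c , proj₁ c∈b/θ) a′) (proj₂ c∈b/θ)))
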